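{- Let $S=\{e_1,\ldots,e_m\}$ be an ordered set, and let $d_nS=\{(M_1^0,M_1^1),\ldots,(M_n^0,M_n^1)\}$ be a special decomposition of the set $S$. The number of elementary operations required to obtain the Boolean function generated by the special decomposition $d_nS$ does not exceed the number $c\times n\times m$ for some constant $c$.
   Context: Special decomposition. An ordered set $d_nS=\{(M_1^0,M_1^1),\ldots,(M_n^0,M_n^1)\}$ of ordered pairs of subsets of $S$ is a special decomposition of $S$ if (1) $M_i^0\cap M_i^1=\emptyset$ for all $i$; (2) for all $i$, $M_i^0\neq\emptyset$ or $M_i^1\neq\emptyset$; (3) $\bigcup_{i=1}^n(M_i^0\cup M_i^1)=S$. Function generated by $d_nS$. With $x_j^0=\bar x_j$, $x_j^1=x_j$, it is $h(x_1,\ldots,x_n)=\bigwedge_{i=1}^m c_i$, where $c_i$ is the disjunction of the literals in $\{x_j^\alpha: e_i\in M_j^\alpha,\ j\in\{1,\ldots,n\},\ \alpha\in\{0,1\}\}$. Representation. $d_nS$ is given by the pair of $(n\times m)$ $(0,1)$-matrices $(sM0,sM1)$, where $sM\alpha(i,j)=1$ if $e_j\in M_i^\alpha$ and $0$ otherwise. The function $h$ is represented by the $(m\times n)$-matrix $(h)\mathrm{cnf}$ with $(h)\mathrm{cnf}(i,j)=-1$ if $\bar x_j$ is in $c_i$, $=1$ if $x_j$ is in $c_i$, and $=0$ if neither is in $c_i$. Elementary operations: assigning a value to a function variable or to an array element; addition and subtraction of numbers; comparison of two numbers; recognition of a literal. "Constant" means independent of $n$, $m$ and the decomposition. -}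

module Defs where

open import Data.Bool.Base using (Bool; true; false; not; _∧_; if_then_else_)
open import Data.Bool.ListAction using (all; any)
open import Data.Fin.Base using (Fin; toℕ)
open import Data.Fin.Subset using (Subset; ⊥; ⊤; _∩_; _∪_; ⋃; Nonempty)
open import Data.Fin.Subset.Properties using (_∈?_)
open import Data.Integer.Base using (ℤ; +_; -1ℤ; 0ℤ; 1ℤ)
import Data.Integer.Base as ℤ
import Data.Integer.Properties as ℤₚ
open import Data.List.Base using (List; []; _∷_; tabulate; allFin; cartesianProduct)
open import Data.Nat.Base using (ℕ; _+_)
import Data.Nat.Properties as ℕₚ
open import Data.Product.Base using (_×_; _,_)
open import Data.Sum.Base using (_⊎_)
open import Relation.Binary.PropositionalEquality.Core using (_≡_)
open import Relation.Nullary.Decidable.Core using (does)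

------------------------------------------------------------------------
-- Special decompositions and the functions they generate

-- The ordered set S = {e₁,…,eₘ} is Fin m.  A superscript α ∈ {0,1} is a
-- Bool: false for 0, true for 1.

record SpecialDecomposition (n m : ℕ) : Set where
  field
    M        : Bool → Fin n → Subset m
    disjoint : ∀ i → M false i ∩ M true i ≡ ⊥
    nonempty : ∀ i → Nonempty (M false i) ⊎ Nonempty (M true i)
    covering : ⋃ (tabulate λ i → M false i ∪ M true i) ≡ ⊤

-- (j , α) is the literal x_j^α, with x_j^0 = x̄_j and x_j^1 = x_j.
Literal : ℕ → Set
Literal n = Fin n × Bool

-- A clause is the disjunction of a set of literals, given by its
-- characteristic function.
Clause : ℕ → Set
Clause n = Literal n → Bool

CNF : ℕ → ℕ → Set
CNF n m = Fin m → Clause n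

literals : ∀ n → List (Literal n)
literals n = cartesianProduct (allFin n) (false ∷ true ∷ [])

literalValue : ∀ {n} → (Fin n → Bool) → Literal n → Bool
literalValue x (j , α) = if α then x j else not (x j)

⟦_⟧ : ∀ {n m} → CNF n m → (Fin n → Bool) → Bool
⟦_⟧ {n} {m} φ x =
  all (λ i → any (λ l → φ i l ∧ literalValue x l) (literals n)) (allFin m)

module _ {n m : ℕ} (d : SpecialDecomposition n m) where
  open SpecialDecomposition d

  generated : CNF n m
  generated i (j , α) = does (i ∈? M α j)

  sM : Bool → Fin n → Fin m → ℤ
  sM α i j = if does (j ∈? M α i) then 1ℤ else 0ℤ

literalCode : Bool → ℤ
literalCode false = -1ℤ
literalCode true  = 1ℤ

-- A is the matrix (h)cnf of the function h = ⟦ φ ⟧ with clauses φ.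
record IsCnfMatrix {n m : ℕ} (φ : CNF n m) (A : Fin m → Fin n → ℤ) : Set where
  field
    negative : ∀ i j → φ i (j , false) ≡ true → A i j ≡ -1ℤ
    positive : ∀ i j → φ i (j , true) ≡ true → A i j ≡ 1ℤ
    absent   : ∀ i j → φ i (j , false) ≡ false → φ i (j , true) ≡ false →
               A i j ≡ 0ℤ

-- The formula read off from a matrix of the form (h)cnf.
fromMatrix : ∀ {n m} → (Fin m → Fin n → ℤ) → CNF n m
fromMatrix A i (j , α) = does (A i j ℤₚ.≟ literalCode α)

------------------------------------------------------------------------
-- Programs over elementary operations

-- Programs act on integer variables and two-dimensional integer arrays,
-- both named by natural numbers.

Var Array : Set
Var   = ℕ
Array = ℕ

infixl 6 _⊕_ _⊖_

data Expr : Set where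
  const   : ℤ → Expr
  var     : Var → Expr
  elem    : Array → Expr → Expr → Expr
  _⊕_ _⊖_ : Expr → Expr → Expr

infix 5 _≐_ _≼_ _≺_

data Test : Set where
  _≐_ _≼_ _≺_ : Expr → Expr → Test
  -- Does the value encode a literal with the given superscript?
  recognise   : Bool → Expr → Test

infix  4 _≔_ _[_,_]≔_
infixr 3 _⨟_

data Program : Set where
  skip          : Program
  _≔_           : Var → Expr → Program
  _[_,_]≔_      : Array → Expr → Expr → Expr → Program
  _⨟_           : Program → Program → Program
  if′_then_else_ : Test → Program → Program → Program
  while_do′_     : Test → Program → Program

record State : Set where
  field
    variables : Var → ℤ
    arrays    : Array → ℤ → ℤ → ℤ

open State public

setVar : Var → ℤ → State → State
setVar x v s = record
  { variables = λ y → if does (y ℕₚ.≟ x) then v else variables s y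
  ; arrays    = arrays s
  }

setElem : Array → ℤ → ℤ → ℤ → State → State
setElem a i j v s = record
  { variables = variables s
  ; arrays    = λ b k l →
      if does (b ℕₚ.≟ a) ∧ does (k ℤₚ.≟ i) ∧ does (l ℤₚ.≟ j)
      then v else arrays s b k l
  }

evalE : Expr → State → ℤ
evalE (const c)    s = c
evalE (var x)      s = variables s x
evalE (elem a e f) s = arrays s a (evalE e s) (evalE f s)
evalE (e ⊕ f)      s = evalE e s ℤ.+ evalE f s
evalE (e ⊖ f)      s = evalE e s ℤ.- evalE f s

evalT : Test → State → Bool
evalT (e ≐ f)         s = does (evalE e s ℤₚ.≟ evalE f s)
evalT (e ≼ f)         s = does (evalE e s ℤₚ.≤? evalE f s)
evalT (e ≺ f)         s = does (evalE e s ℤₚ.<? evalE f s)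
evalT (recognise α e) s = does (evalE e s ℤₚ.≟ literalCode α)

-- The elementary operations, each of cost 1, are: assignment to a variable
-- or to an array element, addition, subtraction, comparison of two numbers,
-- and recognition of a literal.  Reading a value is not one of them.

costE : Expr → ℕ
costE (const c)    = 0
costE (var x)      = 0
costE (elem a e f) = costE e + costE f
costE (e ⊕ f)      = 1 + costE e + costE f
costE (e ⊖ f)      = 1 + costE e + costE f

costT : Test → ℕ
costT (e ≐ f)         = 1 + costE e + costE f
costT (e ≼ f)         = 1 + costE e + costE f
costT (e ≺ f)         = 1 + costE e + costE f
costT (recognise α e) = 1 + costE e

-- ⟨ p , s ⟩⇓⟨ t , k ⟩ : started in s, the program p halts in t after
-- performing exactly k elementary operations.

data ⟨_,_⟩⇓⟨_,_⟩ : Program → State → State → ℕ → Set where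
  skip   : ∀ {s} → ⟨ skip , s ⟩⇓⟨ s , 0 ⟩
  assign : ∀ {x e s} →
           ⟨ x ≔ e , s ⟩⇓⟨ setVar x (evalE e s) s , 1 + costE e ⟩
  store  : ∀ {a e f g s} →
           ⟨ a [ e , f ]≔ g , s ⟩⇓⟨
             setElem a (evalE e s) (evalE f s) (evalE g s) s ,
             1 + costE e + costE f + costE g ⟩
  seq    : ∀ {p q s t u k l} →
           ⟨ p , s ⟩⇓⟨ t , k ⟩ → ⟨ q , t ⟩⇓⟨ u , l ⟩ →
           ⟨ p ⨟ q , s ⟩⇓⟨ u , k + l ⟩
  ifTrue : ∀ {b p q s t k} → evalT b s ≡ true →
           ⟨ p , s ⟩⇓⟨ t , k ⟩ →
           ⟨ if′ b then p else q , s ⟩⇓⟨ t , costT b + k ⟩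
  ifFalse : ∀ {b p q s t k} → evalT b s ≡ false →
           ⟨ q , s ⟩⇓⟨ t , k ⟩ →
           ⟨ if′ b then p else q , s ⟩⇓⟨ t , costT b + k ⟩
  whileFalse : ∀ {b p s} → evalT b s ≡ false →
           ⟨ while b do′ p , s ⟩⇓⟨ s , costT b ⟩
  whileTrue : ∀ {b p s t u k l} → evalT b s ≡ true →
           ⟨ p , s ⟩⇓⟨ t , k ⟩ → ⟨ while b do′ p , t ⟩⇓⟨ u , l ⟩ →
           ⟨ while b do′ p , s ⟩⇓⟨ u , costT b + k + l ⟩

------------------------------------------------------------------------
-- Input and output conventions

-- Matrix indices start from 0.  Variables 0 and 1 hold n and m; arrays 0
-- and 1 hold sM0 and sM1; array 2 receives (h)cnf.

sMArray : Bool → Array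
sMArray false = 0
sMArray true  = 1

-- All other variables and array entries, including array 2, are arbitrary.
record HoldsInput {n m : ℕ} (d : SpecialDecomposition n m) (s : State) : Set where
  field
    numberOfPairs    : variables s 0 ≡ + n
    numberOfElements : variables s 1 ≡ + m
    matrices         : ∀ α (i : Fin n) (j : Fin m) →
      arrays s (sMArray α) (+ toℕ i) (+ toℕ j) ≡ sM d α i j

output : ∀ n m → State → Fin m → Fin n → ℤ
output n m s i j = arrays s 2 (+ toℕ i) (+ toℕ j)

record HoldsGeneratedFunction {n m : ℕ} (d : SpecialDecomposition n m)
                              (s : State) : Set where
  field
    isCnfMatrix : IsCnfMatrix (generated d) (output n m s)
    sameValues  : ∀ x → ⟦ fromMatrix (output n m s) ⟧ x ≡ ⟦ generated d ⟧ x

{-# OPTIONS --safe #-}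
-- The clauses can be written down without branching: since M_j^0 and M_j^1 are
-- disjoint, (h)cnf(i,j) = sM1(j,i) − sM0(j,i).  Two nested loops fill the matrix
-- with 5nm + 5n + 2 operations, and n ≥ 1 because the pairs cover S ≠ ∅.
module Submission where

open import Defs
open import Data.Bool.Base using (Bool; true; false; _∧_; if_then_else_)
open import Data.Bool.ListAction using (and; or)
open import Data.Fin.Base using (Fin; toℕ)
open import Data.Fin.Properties using (toℕ<n)
open import Data.Fin.Subset using (_∈_)
open import Data.Fin.Subset.Properties using (_∈?_; ∉⊥; x∈p∩q⁺)
open import Data.Integer.Base using (ℤ; +_; 0ℤ; 1ℤ; +<+)
import Data.Integer.Base as ℤ
import Data.Integer.Properties as ℤₚ
open import Data.List.Base using (allFin)
open import Data.List.Properties using (map-cong)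
open import Data.Nat.Base using (ℕ; zero; suc; _+_; _*_; _≤_; _<_; s≤s; NonZero)
import Data.Nat.Properties as ℕₚ
open import Data.Nat.Tactic.RingSolver using (solve-∀)
open import Data.Product.Base using (∃-syntax; _×_; _,_; proj₁; proj₂)
open import Data.Sum.Base using (_⊎_; inj₁; inj₂)
open import Relation.Binary.PropositionalEquality
open import Relation.Nullary using (¬_; contradiction)
open import Relation.Nullary.Decidable using (yes; no; dec-true; dec-false)

indicator : Bool → ℤ
indicator b = if b then 1ℤ else 0ℤ

module _ {n m : ℕ} {φ : CNF n m} {A : Fin m → Fin n → ℤ}
  (exclusive  : ∀ i j → φ i (j , false) ∧ φ i (j , true) ≡ false)
  (difference : ∀ i j → A i j ≡ indicator (φ i (j , true)) ℤ.- indicator (φ i (j , false)))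
  where

  -- By `exclusive` at most one of the two literals occurs, and the three remaining patterns have
  -- differences -1, 1 and 0, exactly the prescribed codes.
  isCnfMatrix-difference : IsCnfMatrix φ A
  isCnfMatrix-difference = record
    { negative = negative ; positive = positive ; absent = absent }
    where
    negative : ∀ i j → φ i (j , false) ≡ true → A i j ≡ literalCode false
    negative i j eq with φ i (j , false) | φ i (j , true) | exclusive i j | difference i j
    ... | true | false | _ | A≡ = A≡

    positive : ∀ i j → φ i (j , true) ≡ true → A i j ≡ literalCode true
    positive i j eq with φ i (j , false) | φ i (j , true) | exclusive i j | difference i j
    ... | false | true | _ | A≡ = A≡

    absent : ∀ i j → φ i (j , false) ≡ false → φ i (j , true) ≡ false → A i j ≡ 0ℤ
    absent i j eq₀ eq₁ with φ i (j , false) | φ i (j , true) | difference i j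
    ... | false | false | A≡ = A≡

  fromMatrix-difference : ∀ i l → fromMatrix A i l ≡ φ i l
  fromMatrix-difference i (j , α) rewrite difference i j
    -- `φ i (j , α)` escapes the abstraction because `α` is still a variable; `eq₀` and `eq₁` supply
    -- its value once `α` is known.
    with φ i (j , false) in eq₀ | φ i (j , true) in eq₁ | exclusive i j | α
  ... | true  | false | _ | false = sym eq₀
  ... | true  | false | _ | true  = sym eq₁
  ... | false | true  | _ | false = sym eq₀
  ... | false | true  | _ | true  = sym eq₁
  ... | false | false | _ | false = sym eq₀
  ... | false | false | _ | true  = sym eq₁

-- `all` and `any` are `and` and `or` of a `map`, so pointwise equality suffices, without function
-- extensionality.
⟦⟧-cong : ∀ {n m} {φ ψ : CNF n m} → (∀ i l → φ i l ≡ ψ i l) → ∀ x → ⟦ φ ⟧ x ≡ ⟦ ψ ⟧ x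
⟦⟧-cong {n} {m} φ≗ψ x = cong and (map-cong
  (λ i → cong or (map-cong (λ l → cong (_∧ literalValue x l) (φ≗ψ i l)) (literals n)))
  (allFin m))

generated-exclusive : ∀ {n m} (d : SpecialDecomposition n m) i j →
  generated d i (j , false) ∧ generated d i (j , true) ≡ false
generated-exclusive d i j
  with i ∈? SpecialDecomposition.M d false j | i ∈? SpecialDecomposition.M d true j
... | yes i∈M⁰ | yes i∈M¹ = contradiction
  (subst (i ∈_) (SpecialDecomposition.disjoint d j)
    (x∈p∩q⁺ (i∈M⁰ , i∈M¹)))
  ∉⊥
... | yes _ | no _  = refl
... | no _  | _     = refl

pairs-nonZero : ∀ {n m} .{{_ : NonZero m}} → SpecialDecomposition n m → NonZero n
-- With no pairs `covering` reads `⊥ ≡ ⊤` over `suc m` points, and the first entries differ.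
pairs-nonZero {zero}  {suc m} d with () ← SpecialDecomposition.covering d
pairs-nonZero {suc n} d = _

-- A total-correctness judgement with exact cost `k` from a fixed start state.
Runs : Program → State → ℕ → (State → Set) → Set
Runs p s k Q = ∃[ t ] (⟨ p , s ⟩⇓⟨ t , k ⟩ × Q t)

runs-seq : ∀ {p q s k l P Q} → Runs p s k P → (∀ {t} → P t → Runs q t l Q) →
  Runs (p ⨟ q) s (k + l) Q
runs-seq (_ , p⇓ , Pt) run-q with run-q Pt
... | u , q⇓ , Qu = u , seq p⇓ q⇓ , Qu

-- Invariant rule for a counting loop: `P i` holds after `i` rounds. Each round costs one comparison
-- and the body; the final 1 is the failing comparison.
runs-while : ∀ {x y body k N} (P : ℕ → State → Set) →
  (∀ {i s} → P i s → variables s x ≡ + i) →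
  (∀ {i s} → P i s → variables s y ≡ + N) →
  (∀ {i s} → i < N → P i s → Runs body s k (P (suc i))) →
  ∀ {s} → P 0 s → Runs (while var x ≺ var y do′ body) s (N * (1 + k) + 1) (P N)
runs-while {x} {y} {body} {k} {N} P counter bound step = loop N 0 refl
  where
  -- Induction on the number `r` of rounds still to come; `i` counts those done.
  loop : ∀ r i → i + r ≡ N → ∀ {s} → P i s →
    Runs (while var x ≺ var y do′ body) s (r * (1 + k) + 1) (P N)
  loop zero i i+0≡N {s} Pi = s , whileFalse (dec-false (_ ℤₚ.<? _) stop) , subst (λ j → P j s) i≡N Pi
    where
    i≡N : i ≡ N
    i≡N = trans (sym (ℕₚ.+-identityʳ i)) i+0≡N
    stop : ¬ (variables s x ℤ.< variables s y)
    stop = ℤₚ.<-irrefl (trans (counter Pi) (trans (cong +_ i≡N) (sym (bound Pi))))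
  loop (suc r) i i+r≡N {s} Pi = continue (step i<N Pi)
    where
    i<N : i < N
    i<N = subst (i <_) i+r≡N (ℕₚ.m<m+n i (ℕₚ.0<1+n {r}))
    continue : Runs body s k (P (suc i)) →
      Runs (while var x ≺ var y do′ body) s (suc r * (1 + k) + 1) (P N)
    continue (_ , body⇓ , Pt) with loop r (suc i) (trans (sym (ℕₚ.+-suc i r)) i+r≡N) Pt
    ... | u , loop⇓ , PN = u ,
      subst (λ l → ⟨ while var x ≺ var y do′ body , s ⟩⇓⟨ u , l ⟩) (sym (ℕₚ.+-assoc (1 + k) (r * (1 + k)) 1))
        (whileTrue
          (dec-true (_ ℤₚ.<? _) (subst₂ ℤ._<_ (sym (counter Pi)) (sym (bound Pi)) (+<+ i<N)))
          body⇓ loop⇓) ,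
      PN

-- Variable 2 counts columns (pairs) and variable 3 rows (elements). The indices are swapped on
-- reading, since the input matrices are n × m and the output is m × n.
fillEntry fillColumn fillMatrix : Program
fillEntry =
  2 [ var 3 , var 2 ]≔ elem 1 (var 2) (var 3) ⊖ elem 0 (var 2) (var 3) ⨟
  3 ≔ var 3 ⊕ const 1ℤ
fillColumn =
  3 ≔ const 0ℤ ⨟
  while var 3 ≺ var 1 do′ fillEntry ⨟
  2 ≔ var 2 ⊕ const 1ℤ
fillMatrix =
  2 ≔ const 0ℤ ⨟
  while var 2 ≺ var 0 do′ fillColumn

increment : ∀ {v} {k : ℕ} → v ≡ + k → v ℤ.+ 1ℤ ≡ + suc k
increment {k = k} refl = cong +_ (ℕₚ.+-comm k 1)

module _ {n m : ℕ} (d : SpecialDecomposition n m) where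

  difference : Fin m → Fin n → ℤ
  difference i j = sM d true j i ℤ.- sM d false j i

  -- Columns before c are filled, and so is column c above row r.
  record Filled (c r : ℕ) (s : State) : Set where
    field
      input  : HoldsInput d s
      column : variables s 2 ≡ + c
      filled : ∀ i j → toℕ j < c ⊎ (toℕ j ≡ c × toℕ i < r) → output n m s i j ≡ difference i j

  open HoldsInput
  open Filled

  -- The form `2 + x` makes the lookups of variables 0 and 1 reduce to their old values.
  setVar-holdsInput : ∀ x {v s} → HoldsInput d s → HoldsInput d (setVar (2 + x) v s)
  setVar-holdsInput x I = record
    { numberOfPairs    = numberOfPairs I
    ; numberOfElements = numberOfElements I
    ; matrices         = matrices I
    }

  -- The cost 4 is a subtraction, a store, an addition and an assignment.
  runs-fillEntry : ∀ {c r s} → Filled c r s × variables s 3 ≡ + r →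
    Runs fillEntry s 4 (λ t → Filled c (suc r) t × variables t 3 ≡ + suc r)
  runs-fillEntry {c} {r} {s} (F , row) = _ , seq store assign ,
    record
      { input = record
        { numberOfPairs    = numberOfPairs (input F)
        ; numberOfElements = numberOfElements (input F)
        -- `sMArray α` must become 0 or 1 before the store into array 2 is seen to leave it alone.
        ; matrices = λ where
            false i j → matrices (input F) false i j
            true  i j → matrices (input F) true i j
        }
      ; column = column F
      ; filled = filled′
      } , increment row
    where
    entry : ℤ
    entry = arrays s 1 (variables s 2) (variables s 3) ℤ.- arrays s 0 (variables s 2) (variables s 3)

    filled′ : ∀ i j → toℕ j < c ⊎ (toℕ j ≡ c × toℕ i < suc r) →
      output n m (setElem 2 (variables s 3) (variables s 2) entry s) i j ≡ difference i j
    -- These are the tests made by `setElem`: the cell passing both holds the new entry, and any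
    -- other cell in question was filled before.
    filled′ i j before with + toℕ i ℤₚ.≟ variables s 3 | + toℕ j ℤₚ.≟ variables s 2
    ... | yes i≡ | yes j≡ rewrite sym i≡ | sym j≡ =
      cong₂ ℤ._-_ (matrices (input F) true j i) (matrices (input F) false j i)
    filled′ i j (inj₁ j<c)         | yes _ | no _ = filled F i j (inj₁ j<c)
    filled′ i j (inj₂ (j≡c , _))   | yes _ | no j≢ =
      contradiction (trans (cong +_ j≡c) (sym (column F))) j≢
    filled′ i j (inj₁ j<c)         | no _  | _ = filled F i j (inj₁ j<c)
    filled′ i j (inj₂ (j≡c , i≤r)) | no i≢ | _ =
      filled F i j (inj₂ (j≡c , ℕₚ.≤∧≢⇒< (ℕₚ.≤-pred i≤r) λ i≡r →
        i≢ (trans (cong +_ i≡r) (sym row))))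

  nextColumn : ∀ {c s v} → v ≡ + suc c → Filled c m s → Filled (suc c) 0 (setVar 2 v s)
  nextColumn {c} {s} v≡ F = record
    { input = setVar-holdsInput 0 (input F)
    ; column = v≡
    ; filled = λ where
        -- A column before `suc c` lies before `c` or is `c` itself, which is complete because all
        -- `m` rows are done.
        i j (inj₁ (s≤s j≤c)) → filled F i j (earlier i j (ℕₚ.m≤n⇒m<n∨m≡n j≤c))
        i j (inj₂ (_ , ()))
    }
    where
    earlier : ∀ (i : Fin m) (j : Fin n) → toℕ j < c ⊎ toℕ j ≡ c →
      toℕ j < c ⊎ (toℕ j ≡ c × toℕ i < m)
    earlier i j (inj₁ j<c) = inj₁ j<c
    earlier i j (inj₂ j≡c) = inj₂ (j≡c , toℕ<n i)

  runs-fillColumn : ∀ {c s} → Filled c 0 s →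
    Runs fillColumn s (1 + ((m * 5 + 1) + 2)) (Filled (suc c) 0)
  runs-fillColumn {c} F =
    runs-seq {P = λ t → Filled c 0 t × variables t 3 ≡ + 0}
      (_ , assign ,
        record { input = setVar-holdsInput 1 (input F) ; column = column F ; filled = filled F } ,
        refl) λ F₀ →
    runs-seq
      (runs-while (λ r t → Filled c r t × variables t 3 ≡ + r)
        proj₂ (λ G → numberOfElements (input (proj₁ G))) (λ _ → runs-fillEntry) F₀)
      λ (G , _) → _ , assign , nextColumn (increment (column G)) G

  runs-fillMatrix : ∀ {s} → HoldsInput d s →
    Runs fillMatrix s (1 + (n * (1 + (1 + ((m * 5 + 1) + 2))) + 1)) (Filled n 0)
  runs-fillMatrix I =
    runs-seq {P = Filled 0 0}
      (_ , assign , record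
        { input = setVar-holdsInput 0 I
        ; column = refl
        ; filled = λ { _ _ (inj₁ ()) ; _ _ (inj₂ (_ , ())) }
        })
      (runs-while (λ c → Filled c 0) column (λ G → numberOfPairs (input G)) (λ _ → runs-fillColumn))

  filled⇒holdsGeneratedFunction : ∀ {s} → Filled n 0 s → HoldsGeneratedFunction d s
  filled⇒holdsGeneratedFunction F = record
    { isCnfMatrix = isCnfMatrix-difference (generated-exclusive d) computed
    ; sameValues  = ⟦⟧-cong (fromMatrix-difference (generated-exclusive d) computed)
    }
    where
    computed : ∀ i j → _ ≡ difference i j
    computed i j = filled F i j (inj₁ (toℕ<n j))

-- The left side is 5nm + 5n + 2. As n, m ≥ 1, its terms are at most 5nm, 5nm and 2nm, whence 12.
fillMatrix-cost : ∀ n m .{{_ : NonZero n}} .{{_ : NonZero m}} →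
  1 + (n * (1 + (1 + ((m * 5 + 1) + 2))) + 1) ≤ 12 * n * m
fillMatrix-cost (suc a) (suc b) =
  -- The added summand is the exact gap between the two sides, written in a = n - 1 and b = m - 1.
  subst (cost ≤_) (slack a b) (ℕₚ.m≤m+n cost (7 * (a * b) + 2 * a + 7 * b))
  where
  cost : ℕ
  cost = 1 + (suc a * (1 + (1 + ((suc b * 5 + 1) + 2))) + 1)
  slack : ∀ a b → 1 + (suc a * (1 + (1 + ((suc b * 5 + 1) + 2))) + 1)
    + (7 * (a * b) + 2 * a + 7 * b) ≡ 12 * suc a * suc b
  slack = solve-∀

proposition5p4 : ∃[ p ] ∃[ c ] (∀ (n m : ℕ) .{{_ : NonZero m}} (d : SpecialDecomposition n m) (s : State) →
    HoldsInput d s →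
    ∃[ t ] ∃[ k ] (⟨ p , s ⟩⇓⟨ t , k ⟩ × HoldsGeneratedFunction d t × k ≤ c * n * m))
proposition5p4 = fillMatrix , 12 , λ n m d s I →
  let t , run , F = runs-fillMatrix d I in
  t , _ , run , filled⇒holdsGeneratedFunction d F , fillMatrix-cost n m {{pairs-nonZero d}}
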